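{- Let $Q$ be a graph property that has an independence function or a clique function $f:\mathbb{N}\to\mathbb{N}$ such that there is a fixed $a\in\mathbb{N}$ with $f(n)\ge n/a$ for all $n\in\mathbb{N}$. Then the graph polynomial $P_Q$ is weakly distinguishing.
   Context: All graphs are finite and simple. A graph property is a class of graphs closed under isomorphism. For $A\subseteq V(G)$, $G[A]$ is the induced subgraph on $A$. A function $f:\mathbb{N}\to\mathbb{N}$ is an independence function (resp. clique function) for a property $Q$ if every graph $G\in Q$ has an independent set (resp. a clique) of size $f(|V(G)|)$. For a property $Q$, $P_Q(G;X)=\sum_{A\subseteq V(G):\, G[A]\in Q} X^{|A|}$. For a graph polynomial $P$ (an isomorphism-invariant map from graphs to polynomials), $G$ is $P$-unique if every graph $H$ with $P(G)=P(H)$ is isomorphic to $G$. Let $\mathcal{G}(n)$ be the set of isomorphism classes of graphs on $n$ vertices and $U_P(n)$ the set of $P$-unique graphs in $\mathcal{G}(n)$. $P$ is weakly distinguishing if $\lim_{n\to\infty}|U_P(n)|/|\mathcal{G}(n)|=0$. -}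

module Defs where

open import Data.Bool.Base using (Bool; true; false)
open import Data.Empty using (⊥)
open import Data.Fin.Base using (Fin; zero; suc)
open import Data.Fin.Permutation using (Permutation; _⟨$⟩ʳ_; _⟨$⟩ˡ_; inverseˡ; inverseʳ; flip; permutation; ↔⇒≡)
open import Data.Fin.Properties using (suc-injective)
open import Data.Fin.Subset using (Subset; inside; outside; ∣_∣; _∈_)
open import Data.Integer.Base using (+_)
open import Data.List.Base using (List; []; _∷_; _++_; map; filter; foldr; replicate)
open import Data.List.Membership.Propositional using () renaming (_∈_ to _∈ˡ_)
open import Data.List.Membership.Propositional.Properties using (∈-map⁺; ∈-map⁻; ∈-++⁺ˡ; ∈-++⁺ʳ; ∈-filter⁺; ∈-filter⁻)
open import Data.List.Membership.Propositional.Properties.WithK using (unique∧set⇒bag)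
open import Data.List.Properties using (map-∘; map-cong)
open import Data.List.Relation.Binary.BagAndSetEquality using (∼bag⇒↭)
open import Data.List.Relation.Binary.Permutation.Propositional using (_↭_)
import Data.List.Relation.Binary.Permutation.Propositional.Properties as ↭
open import Data.List.Relation.Unary.All using ([])
open import Data.List.Relation.Unary.AllPairs using ([]; _∷_)
open import Data.List.Relation.Unary.Any using (here)
open import Data.List.Relation.Unary.Unique.Propositional using (Unique)
import Data.List.Relation.Unary.Unique.Propositional.Properties as Uniq
open import Data.Nat.Base using (ℕ; zero; suc; _+_; _≤_; NonZero)
open import Data.Nat.ListAction using (sum)
open import Data.Nat.ListAction.Properties using (sum-↭)
open import Data.Nat.Properties using (+-identityʳ)
open import Data.Product.Base using (∃-syntax; _×_; _,_; proj₂)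
open import Data.Rational.Unnormalised.Base as ℚᵘ using (ℚᵘ; 0ℚᵘ)
open import Data.Unit.Base using (⊤)
open import Data.Vec.Base using ([]; _∷_; here; there; lookup; tabulate)
open import Data.Vec.Properties using (∷-injectiveʳ; lookup⇒[]=; []=⇒lookup; lookup∘tabulate; tabulate∘lookup; tabulate-cong)
open import Function.Bundles using (mk⇔)
open import Relation.Binary.PropositionalEquality using (_≡_; _≢_; refl; sym; trans; cong; cong₂; subst; module ≡-Reasoning)
open import Relation.Nullary using (Dec)

record Graph (n : ℕ) : Set where
  field
    adj    : Fin n → Fin n → Bool
    irrefl : ∀ v → adj v v ≡ false
    symm   : ∀ u v → adj u v ≡ adj v u

open Graph public

infix 4 _≅_

record _≅_ {m n : ℕ} (G : Graph m) (H : Graph n) : Set where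
  constructor mk≅
  field
    bij      : Permutation m n
    preserve : ∀ u v → adj G u v ≡ adj H (bij ⟨$⟩ʳ u) (bij ⟨$⟩ʳ v)

open _≅_ public

≅-sym : ∀ {m n} {G : Graph m} {H : Graph n} → G ≅ H → H ≅ G
≅-sym {H = H} (mk≅ π p) = mk≅ (flip π) λ u v →
  sym (trans (p _ _) (cong₂ (adj H) (inverseʳ π) (inverseʳ π)))

record GraphProperty : Set₁ where
  field
    Holds  : ∀ {n} → Graph n → Set
    closed : ∀ {m n} {G : Graph m} {H : Graph n} → G ≅ H → Holds G → Holds H

open GraphProperty public

-- The increasing enumeration of the elements of A.
enum : ∀ {n} (A : Subset n) → Fin ∣ A ∣ → Fin n
enum (inside  ∷ A) zero    = zero
enum (inside  ∷ A) (suc i) = suc (enum A i)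
enum (outside ∷ A) i       = suc (enum A i)

infix 9 _[_]

-- The induced subgraph G[A], with its vertex set A relabelled along enum.
_[_] : ∀ {n} → Graph n → (A : Subset n) → Graph ∣ A ∣
G [ A ] = record
  { adj    = λ i j → adj G (enum A i) (enum A j)
  ; irrefl = λ i → irrefl G (enum A i)
  ; symm   = λ i j → symm G (enum A i) (enum A j)
  }

Independent : ∀ {n} → Graph n → Subset n → Set
Independent G A = ∀ u v → u ∈ A → v ∈ A → adj G u v ≡ false

Clique : ∀ {n} → Graph n → Subset n → Set
Clique G A = ∀ u v → u ∈ A → v ∈ A → u ≢ v → adj G u v ≡ true

IndependenceFunction : GraphProperty → (ℕ → ℕ) → Set
IndependenceFunction Q f =
  ∀ {n} (G : Graph n) → Holds Q G → ∃[ A ] ∣ A ∣ ≡ f n × Independent G A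

CliqueFunction : GraphProperty → (ℕ → ℕ) → Set
CliqueFunction Q f =
  ∀ {n} (G : Graph n) → Holds Q G → ∃[ A ] ∣ A ∣ ≡ f n × Clique G A

-- Polynomials in ℕ[X] as coefficient lists, constant term first; they are
-- compared by _≈_, which ignores trailing zeros.
Poly : Set
Poly = List ℕ

coeff : Poly → ℕ → ℕ
coeff []      _       = 0
coeff (c ∷ p) zero    = c
coeff (c ∷ p) (suc k) = coeff p k

infix 4 _≈_

_≈_ : Poly → Poly → Set
p ≈ q = ∀ k → coeff p k ≡ coeff q k

infixl 6 _⊕_

_⊕_ : Poly → Poly → Poly
[]      ⊕ q       = q
(c ∷ p) ⊕ []      = c ∷ p
(c ∷ p) ⊕ (d ∷ q) = (c + d) ∷ (p ⊕ q)

X^_ : ℕ → Poly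
X^ k = replicate k 0 ++ (1 ∷ [])

record GraphPolynomial : Set where
  field
    ⟦_⟧       : ∀ {n} → Graph n → Poly
    invariant : ∀ {m n} {G : Graph m} {H : Graph n} → G ≅ H → ⟦ G ⟧ ≈ ⟦ H ⟧

open GraphPolynomial public

subsets : ∀ n → List (Subset n)
subsets zero    = [] ∷ []
subsets (suc n) = map (outside ∷_) (subsets n) ++ map (inside ∷_) (subsets n)

-- Membership must be decided to form the sum over {A : G[A] ∈ Q};
-- excluded middle provides a decider for every property.
Decider : GraphProperty → Set
Decider Q = ∀ {n} (G : Graph n) → Dec (Holds Q G)

genPoly : (Q : GraphProperty) → Decider Q → ∀ {n} → Graph n → Poly
genPoly Q Q? {n} G =
  foldr _⊕_ [] (map (λ A → X^ ∣ A ∣) (filter (λ A → Q? (G [ A ])) (subsets n)))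

module Invariance where

  coeff-⊕ : ∀ p q k → coeff (p ⊕ q) k ≡ coeff p k + coeff q k
  coeff-⊕ []      q       k       = refl
  coeff-⊕ (c ∷ p) []      k       = sym (+-identityʳ _)
  coeff-⊕ (c ∷ p) (d ∷ q) zero    = refl
  coeff-⊕ (c ∷ p) (d ∷ q) (suc k) = coeff-⊕ p q k

  coeff-sum : ∀ {S : Set} (t : S → Poly) xs k →
              coeff (foldr _⊕_ [] (map t xs)) k ≡ sum (map (λ x → coeff (t x) k) xs)
  coeff-sum t []       k = refl
  coeff-sum t (x ∷ xs) k =
    trans (coeff-⊕ (t x) _ k) (cong (λ s → coeff (t x) k + s) (coeff-sum t xs k))

  ∈-subsets : ∀ {n} (A : Subset n) → A ∈ˡ subsets n
  ∈-subsets []            = here refl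
  ∈-subsets (outside ∷ A) = ∈-++⁺ˡ (∈-map⁺ _ (∈-subsets A))
  ∈-subsets (inside  ∷ A) = ∈-++⁺ʳ _ (∈-map⁺ _ (∈-subsets A))

  subsets-unique : ∀ n → Unique (subsets n)
  subsets-unique zero    = [] ∷ []
  subsets-unique (suc n) = Uniq.++⁺
    (Uniq.map⁺ ∷-injectiveʳ (subsets-unique n))
    (Uniq.map⁺ ∷-injectiveʳ (subsets-unique n))
    λ where (p , q) → disj (∈-map⁻ _ p) (∈-map⁻ _ q)
    where
    disj : ∀ {B : Subset (suc n)} →
           ∃[ A ] A ∈ˡ subsets n × B ≡ outside ∷ A →
           ∃[ A ] A ∈ˡ subsets n × B ≡ inside ∷ A → ⊥
    disj (_ , _ , refl) (_ , _ , ())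

  pos : ∀ {n} {A : Subset n} v → v ∈ A → Fin ∣ A ∣
  pos {A = inside  ∷ A} zero    here      = zero
  pos {A = inside  ∷ A} (suc v) (there p) = suc (pos v p)
  pos {A = outside ∷ A} (suc v) (there p) = pos v p

  enum-pos : ∀ {n} {A : Subset n} v (p : v ∈ A) → enum A (pos v p) ≡ v
  enum-pos {A = inside  ∷ A} zero    here      = refl
  enum-pos {A = inside  ∷ A} (suc v) (there p) = cong suc (enum-pos v p)
  enum-pos {A = outside ∷ A} (suc v) (there p) = cong suc (enum-pos v p)

  enum-∈ : ∀ {n} (A : Subset n) i → enum A i ∈ A
  enum-∈ (inside  ∷ A) zero    = here
  enum-∈ (inside  ∷ A) (suc i) = there (enum-∈ A i)
  enum-∈ (outside ∷ A) i       = there (enum-∈ A i)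

  enum-injective : ∀ {n} (A : Subset n) {i j} → enum A i ≡ enum A j → i ≡ j
  enum-injective (inside ∷ A) {zero}  {zero}  _ = refl
  enum-injective (inside ∷ A) {suc i} {suc j} e =
    cong suc (enum-injective A (suc-injective e))
  enum-injective (outside ∷ A) e = enum-injective A (suc-injective e)

  image : ∀ {m n} → Permutation m n → Subset m → Subset n
  image π A = tabulate (λ v → lookup A (π ⟨$⟩ˡ v))

  image-flip : ∀ {m n} (π : Permutation m n) A → image (flip π) (image π A) ≡ A
  image-flip π A = trans
    (tabulate-cong λ v → trans (lookup∘tabulate _ (π ⟨$⟩ʳ v)) (cong (lookup A) (inverseˡ π)))
    (tabulate∘lookup A)

  image-injective : ∀ {m n} (π : Permutation m n) {A B} → image π A ≡ image π B → A ≡ B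
  image-injective π {A} {B} e =
    trans (sym (image-flip π A)) (trans (cong (image (flip π)) e) (image-flip π B))

  ∈-image : ∀ {m n} (π : Permutation m n) {A v} → v ∈ A → π ⟨$⟩ʳ v ∈ image π A
  ∈-image π {A} {v} p = lookup⇒[]= _ _
    (trans (lookup∘tabulate _ (π ⟨$⟩ʳ v)) (trans (cong (lookup A) (inverseˡ π)) ([]=⇒lookup p)))

  image-∈ : ∀ {m n} (π : Permutation m n) {A v} → v ∈ image π A → π ⟨$⟩ˡ v ∈ A
  image-∈ π {A} {v} p = lookup⇒[]= _ _ (trans (sym (lookup∘tabulate _ v)) ([]=⇒lookup p))

  induced≅ : ∀ {m n} {G : Graph m} {H : Graph n} (φ : G ≅ H) (A : Subset m) →
             G [ A ] ≅ H [ image (bij φ) A ]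
  induced≅ {H = H} (mk≅ π p) A = mk≅ (permutation to from to∘from from∘to) λ i j →
    trans (p _ _) (sym (cong₂ (adj H) (enum-pos _ _) (enum-pos _ _)))
    where
    B = image π A
    to : Fin ∣ A ∣ → Fin ∣ B ∣
    to i = pos (π ⟨$⟩ʳ enum A i) (∈-image π (enum-∈ A i))
    from : Fin ∣ B ∣ → Fin ∣ A ∣
    from j = pos (π ⟨$⟩ˡ enum B j) (image-∈ π {A} (enum-∈ B j))
    to∘from : ∀ j → to (from j) ≡ j
    to∘from j = enum-injective B
      (trans (enum-pos _ _) (trans (cong (π ⟨$⟩ʳ_) (enum-pos _ _)) (inverseʳ π)))
    from∘to : ∀ i → from (to i) ≡ i
    from∘to i = enum-injective A
      (trans (enum-pos _ _) (trans (cong (π ⟨$⟩ˡ_) (enum-pos _ _)) (inverseˡ π)))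

  genPoly-invariant : (Q : GraphProperty) (Q? : Decider Q) →
                      ∀ {m n} {G : Graph m} {H : Graph n} → G ≅ H → genPoly Q Q? G ≈ genPoly Q Q? H
  genPoly-invariant Q Q? {m} {n} {G} {H} φ k = begin
    coeff (genPoly Q Q? G) k        ≡⟨ coeff-sum _ AG k ⟩
    sum (map w AG)                  ≡⟨ cong sum (map-cong w∘σ AG) ⟩
    sum (map (λ A → w (σ A)) AG)    ≡⟨ cong sum (map-∘ AG) ⟩
    sum (map w (map σ AG))          ≡⟨ sum-↭ (↭.map⁺ w σAG↭AH) ⟩
    sum (map w AH)                  ≡⟨ sym (coeff-sum _ AH k) ⟩
    coeff (genPoly Q Q? H) k        ∎
    where
    open ≡-Reasoning
    σ = image (bij φ)
    AG = filter (λ A → Q? (G [ A ])) (subsets m)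
    AH = filter (λ A → Q? (H [ A ])) (subsets n)

    w : ∀ {l} → Subset l → ℕ
    w A = coeff (X^ ∣ A ∣) k

    w∘σ : ∀ A → w A ≡ w (σ A)
    w∘σ A = cong (λ s → coeff (X^ s) k) (↔⇒≡ (bij (induced≅ φ A)))

    σAG⊆AH : ∀ {B} → B ∈ˡ map σ AG → B ∈ˡ AH
    σAG⊆AH B∈ with ∈-map⁻ σ B∈
    ... | A , A∈ , refl = ∈-filter⁺ _ (∈-subsets _)
      (closed Q (induced≅ φ A) (proj₂ (∈-filter⁻ (λ A → Q? (G [ A ])) {xs = subsets m} A∈)))

    AH⊆σAG : ∀ {B} → B ∈ˡ AH → B ∈ˡ map σ AG
    AH⊆σAG {B} B∈ = subst (_∈ˡ map σ AG) (image-flip (flip (bij φ)) B)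
      (∈-map⁺ σ (∈-filter⁺ _ (∈-subsets _)
        (closed Q (induced≅ (≅-sym φ) B) (proj₂ (∈-filter⁻ (λ A → Q? (H [ A ])) {xs = subsets n} B∈)))))

    σAG↭AH : map σ AG ↭ AH
    σAG↭AH = ∼bag⇒↭ (unique∧set⇒bag
      (Uniq.map⁺ (image-injective (bij φ)) (Uniq.filter⁺ _ (subsets-unique m)))
      (Uniq.filter⁺ _ (subsets-unique n))
      (mk⇔ σAG⊆AH AH⊆σAG))

open Invariance using (genPoly-invariant)

P[_] : (Q : GraphProperty) → Decider Q → GraphPolynomial
P[ Q ] Q? = record { ⟦_⟧ = genPoly Q Q? ; invariant = genPoly-invariant Q Q? }

-- H ranges over graphs with any number of vertices.
IsUnique : GraphPolynomial → ∀ {n} → Graph n → Set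
IsUnique P G = ∀ {m} (H : Graph m) → ⟦ P ⟧ G ≈ ⟦ P ⟧ H → H ≅ G

-- The graphs on n vertices satisfying S form exactly c isomorphism classes.
record Classes {n : ℕ} (S : Graph n → Set) (c : ℕ) : Set where
  field
    rep      : Fin c → Graph n
    rep-S    : ∀ i → S (rep i)
    distinct : ∀ i j → rep i ≅ rep j → i ≡ j
    complete : ∀ G → S G → ∃[ i ] G ≅ rep i

infix 4 _⟶_

_⟶_ : (ℕ → ℚᵘ) → ℚᵘ → Set
s ⟶ l = ∀ ε → 0ℚᵘ ℚᵘ.< ε → ∃[ N ] ∀ n → N ≤ n → ℚᵘ.∣ s n ℚᵘ.- l ∣ ℚᵘ.< ε

-- Classes S c determines c, so ∣U∣ n and ∣𝒢∣ n are the numbers |U_P(n)| and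
-- |𝒢(n)|; their existence is part of the claim.
record WeaklyDistinguishing (P : GraphPolynomial) : Set where
  field
    ∣U∣         : ℕ → ℕ
    ∣𝒢∣         : ℕ → ℕ
    ∣U∣-size    : ∀ n → Classes (IsUnique P {n}) (∣U∣ n)
    ∣𝒢∣-size    : ∀ n → Classes {n} (λ _ → ⊤) (∣𝒢∣ n)
    ∣𝒢∣-nonZero : ∀ n → NonZero (∣𝒢∣ n)
    limit       : (λ n → ℚᵘ._/_ (+ ∣U∣ n) (∣𝒢∣ n) {{∣𝒢∣-nonZero n}}) ⟶ 0ℚᵘ

{-# OPTIONS --safe #-}
-- Let k be a small constant fraction of n. A graph G on n vertices
-- without an independent set (clique) of size k has no induced subgraph in Q on k a
-- or more vertices, so P_Q(G) is one of at most 2^((n+1) k a) polynomials, each of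
-- which belongs to at most one P_Q-unique graph. The remaining graphs number at most
-- 2^(n + C(n,2) − C(k,2)), since the pairs inside a homogeneous k-set carry no
-- information. As there are at least 2^C(n,2) / n^n isomorphism classes, both counts
-- are negligible. Taking k linear, instead of logarithmic as in the usual bound on
-- the independence number, is what pays for the factor n^n, so that no
-- information on automorphism groups is needed.
module Submission where

open import Defs
open import Axiom.ExcludedMiddle using (ExcludedMiddle)
open import Data.Bool.Base using (Bool; true; false)
open import Data.Fin.Base using (Fin; zero; suc; fromℕ<; toℕ; combine; join; splitAt; funToFin; finToFun)
open import Data.Fin.Permutation as Perm using (_⟨$⟩ʳ_; _∘ₚ_)
open import Data.Fin.Properties using (2↔Bool; finToFun-funToFin; funToFin-finToFin; combine-injective; splitAt-join; injective⇒≤; fromℕ<-injective; toℕ-fromℕ<)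
open import Data.Fin.Subset using (Subset; inside; outside; ∣_∣; _∈_; ∁) renaming (⊤ to full)
open import Data.Fin.Subset.Properties using (_∈?_; x∉p⇒x∈∁p; ∈⊤; ∣⊤∣≡n; ∣∁p∣≡n∸∣p∣; ∣p∣≤n)
import Data.Integer.Base as ℤ
import Data.Integer.Properties as ℤ
open import Data.List.Base using (List; []; _∷_; _++_; map; filter; length)
open import Data.List.Membership.Propositional using () renaming (_∈_ to _∈ˡ_)
open import Data.List.Membership.Propositional.Properties using (∈-map⁺; ∈-filter⁻)
open import Data.List.Properties using (length-map; length-++; length-filter)
open import Data.List.Relation.Unary.Any using (here; there)
open import Data.Nat.Base using (ℕ; zero; suc; _+_; _*_; _∸_; _^_; _≤_; _<_; z≤n; s≤s; NonZero)
open import Data.Nat.DivMod using (_%_; m≡m%n+[m/n]*n; m%n<n; /-monoˡ-≤; m*n/n≡m)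
import Data.Nat.DivMod as ℕ
open import Data.Nat.ListAction using (sum)
open import Data.Nat.Properties
open import Data.Nat.Tactic.RingSolver using (solve-∀)
open import Data.Product.Base using (∃-syntax; _×_; _,_; proj₁; proj₂)
open import Data.Rational.Unnormalised.Base as ℚᵘ using (mkℚᵘ; 0ℚᵘ; _/_; _≥_; *≤*; *<*)
import Data.Rational.Unnormalised.Properties as ℚᵘ
open import Data.Sum.Base using (_⊎_; inj₁; inj₂)
open import Data.Sum.Properties using (inj₁-injective; inj₂-injective)
open import Data.Unit.Base using (⊤; tt)
open import Data.Vec.Base as Vec using (Vec; []; _∷_; here; there; lookup; tabulate; take; drop; padRight; truncate)
import Data.Vec.Properties as Vec
open import Function.Base using (_∘_)
open import Function.Bundles using (Inverse)
open import Function.Definitions using (Injective)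
open import Level using (0ℓ)
open import Relation.Binary.PropositionalEquality using (_≡_; _≢_; _≗_; refl; sym; trans; cong; cong₂; subst; subst₂; module ≡-Reasoning)
open import Relation.Nullary using (yes; no; ¬_; contradiction)

open Invariance using (coeff-sum; ∈-subsets; pos; enum-pos)

-- Finite codes: functions and bit vectors as elements of `Fin`, for counting by injections

2^n+2^n≡2^[1+n] : ∀ n → 2 ^ n + 2 ^ n ≡ 2 ^ suc n
2^n+2^n≡2^[1+n] n = cong (2 ^ n +_) (sym (+-identityʳ (2 ^ n)))

funToFin-cong : ∀ {m n} {f g : Fin m → Fin n} → f ≗ g → funToFin f ≡ funToFin g
funToFin-cong {zero}  f≗g = refl
funToFin-cong {suc m} f≗g = cong₂ combine (f≗g zero) (funToFin-cong (f≗g ∘ suc))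

funToFin-injective : ∀ {m n} {f g : Fin m → Fin n} → funToFin f ≡ funToFin g → f ≗ g
funToFin-injective {f = f} {g} e x =
  trans (sym (finToFun-funToFin f x)) (trans (cong (λ i → finToFun i x) e) (finToFun-funToFin g x))

finToFun-injective : ∀ {m n} {i j : Fin (n ^ m)} → finToFun {n} {m} i ≗ finToFun j → i ≡ j
finToFun-injective {m} {n} {i} {j} e =
  trans (sym (funToFin-finToFin {m} {n} i)) (trans (funToFin-cong e) (funToFin-finToFin {m} {n} j))

bitsToFin : ∀ {m} → Vec Bool m → Fin (2 ^ m)
bitsToFin v = funToFin (Inverse.from 2↔Bool ∘ lookup v)

bitsToFin-injective : ∀ {m} → Injective _≡_ _≡_ (bitsToFin {m})
bitsToFin-injective {x = v} {w} e = begin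
  v                    ≡⟨ Vec.tabulate∘lookup v ⟨
  tabulate (lookup v)  ≡⟨ Vec.tabulate-cong (λ i → Inverse.strictlyInverseˡ 2↔Bool (lookup v i)) ⟨
  tabulate (λ i → Inverse.to 2↔Bool (Inverse.from 2↔Bool (lookup v i)))
    ≡⟨ Vec.tabulate-cong (λ i → cong (Inverse.to 2↔Bool) (funToFin-injective e i)) ⟩
  tabulate (λ i → Inverse.to 2↔Bool (Inverse.from 2↔Bool (lookup w i)))
    ≡⟨ Vec.tabulate-cong (λ i → Inverse.strictlyInverseˡ 2↔Bool (lookup w i)) ⟩
  tabulate (lookup w)  ≡⟨ Vec.tabulate∘lookup w ⟩
  w                    ∎
  where open ≡-Reasoning

finToBits : ∀ m → Fin (2 ^ m) → Vec Bool m
finToBits m i = tabulate (Inverse.to 2↔Bool ∘ finToFun {2} {m} i)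

finToBits-injective : ∀ m → Injective _≡_ _≡_ (finToBits m)
finToBits-injective m {i} {j} e = finToFun-injective {m} {2} λ x → begin
  finToFun {2} {m} i x                                              ≡⟨ Inverse.strictlyInverseʳ 2↔Bool _ ⟨
  Inverse.from 2↔Bool (Inverse.to 2↔Bool (finToFun {2} {m} i x))    ≡⟨ cong (Inverse.from 2↔Bool) (Vec.lookup∘tabulate _ x) ⟨
  Inverse.from 2↔Bool (lookup (finToBits m i) x)                    ≡⟨ cong (λ v → Inverse.from 2↔Bool (lookup v x)) e ⟩
  Inverse.from 2↔Bool (lookup (finToBits m j) x)                    ≡⟨ cong (Inverse.from 2↔Bool) (Vec.lookup∘tabulate _ x) ⟩
  Inverse.from 2↔Bool (Inverse.to 2↔Bool (finToFun {2} {m} j x))    ≡⟨ Inverse.strictlyInverseʳ 2↔Bool _ ⟩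
  finToFun {2} {m} j x                                              ∎
  where open ≡-Reasoning

join-injective : ∀ m n → Injective _≡_ _≡_ (join m n)
join-injective m n {x} {y} e =
  trans (sym (splitAt-join m n x)) (trans (cong (splitAt m) e) (splitAt-join m n y))

-- Isomorphism classes

≅-trans : ∀ {l m n} {G : Graph l} {H : Graph m} {K : Graph n} → G ≅ H → H ≅ K → G ≅ K
≅-trans (mk≅ π p) (mk≅ ρ q) = mk≅ (π ∘ₚ ρ) λ u v → trans (p u v) (q _ _)

adj-≗⇒≅ : ∀ {n} {G H : Graph n} → (∀ u v → adj G u v ≡ adj H u v) → G ≅ H
adj-≗⇒≅ e = mk≅ Perm.id e

IsUnique-resp-≅ : ∀ P {n} {G H : Graph n} → G ≅ H → IsUnique P G → IsUnique P H
IsUnique-resp-≅ P G≅H uG K e =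
  ≅-trans (uG K λ k → trans (invariant P G≅H k) (e k)) G≅H

module _ (em : ExcludedMiddle 0ℓ) {n} (S : Graph n → Set) where

  record PartialClasses (Gs : List (Graph n)) : Set where
    field
      count    : ℕ
      rep      : Fin count → Graph n
      rep-S    : ∀ i → S (rep i)
      distinct : ∀ i j → rep i ≅ rep j → i ≡ j
      covers   : ∀ {G} → G ∈ˡ Gs → S G → ∃[ i ] G ≅ rep i

  -- Greedy selection along the list: a graph becomes a new representative exactly when it satisfies
  -- `S` and is isomorphic to none of those already chosen. Both tests are decided by excluded
  -- middle.
  partialClasses : ∀ Gs → PartialClasses Gs
  partialClasses [] = record
    { count = 0 ; rep = λ () ; rep-S = λ () ; distinct = λ () ; covers = λ () }
  partialClasses (G ∷ Gs) with partialClasses Gs | em {S G}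
  ... | C | no ¬SG = record
    { PartialClasses C
    ; covers = λ { (here refl) SG → contradiction SG ¬SG ; (there H∈) → PartialClasses.covers C H∈ } }
  ... | C | yes SG with em {∃[ i ] G ≅ PartialClasses.rep C i}
  ...   | yes r = record
    { PartialClasses C
    ; covers = λ { (here refl) _ → r ; (there H∈) → PartialClasses.covers C H∈ } }
  ...   | no ¬r = record
    { count    = suc count
    ; rep      = λ { zero → G ; (suc i) → rep i }
    ; rep-S    = λ { zero → SG ; (suc i) → rep-S i }
    ; distinct = λ { zero    zero    _ → refl
                   ; zero    (suc j) e → contradiction (j , e) ¬r
                   ; (suc i) zero    e → contradiction (i , ≅-sym e) ¬r
                   ; (suc i) (suc j) e → cong suc (distinct i j e) }
    ; covers   = λ { (here refl) _ → zero , adj-≗⇒≅ (λ _ _ → refl)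
                   ; (there H∈) SH → let i , e = covers H∈ SH in suc i , e } }
    where open PartialClasses C

  classes : (∀ {G H} → G ≅ H → S G → S H) →
            (Gs : List (Graph n)) → (∀ G → ∃[ H ] H ∈ˡ Gs × G ≅ H) → ∃[ c ] Classes S c
  classes resp Gs all = _ , record
    { rep      = rep
    ; rep-S    = rep-S
    ; distinct = distinct
    ; complete = λ G SG → let H , H∈ , G≅H = all G
                              i , H≅ = covers H∈ (resp G≅H SG)
                          in i , ≅-trans G≅H H≅
    }
    where open PartialClasses (partialClasses Gs)

-- Counting graphs

-- The binomial coefficient C(n,2), in the recursion by which `cone` adds vertex `zero` with its `n`
-- possible edges; `decode` follows the same recursion.
pairs : ℕ → ℕ
pairs zero    = 0
pairs (suc n) = n + pairs n

pairs-mono-≤ : ∀ {m n} → m ≤ n → pairs m ≤ pairs n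
pairs-mono-≤ z≤n       = z≤n
pairs-mono-≤ (s≤s m≤n) = +-mono-≤ m≤n (pairs-mono-≤ m≤n)

2pairs+n≡n² : ∀ n → pairs n + pairs n + n ≡ n * n
2pairs+n≡n² zero    = refl
2pairs+n≡n² (suc n) = begin
  n + pairs n + (n + pairs n) + suc n      ≡⟨ regroup n (pairs n) ⟩
  suc (n + n + (pairs n + pairs n + n))    ≡⟨ cong (λ s → suc (n + n + s)) (2pairs+n≡n² n) ⟩
  suc (n + n + n * n)                      ≡⟨ square n ⟩
  suc n * suc n                            ∎
  where
  open ≡-Reasoning
  regroup : ∀ n p → n + p + (n + p) + suc n ≡ suc (n + n + (p + p + n))
  regroup = solve-∀
  square : ∀ n → suc (n + n + n * n) ≡ suc n * suc n
  square = solve-∀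

cone : ∀ {n} → Vec Bool n → Graph n → Graph (suc n)
cone {n} row G = record { adj = adj′ ; irrefl = irrefl′ ; symm = symm′ }
  where
  adj′ : Fin (suc n) → Fin (suc n) → Bool
  adj′ zero    zero    = false
  adj′ zero    (suc v) = lookup row v
  adj′ (suc u) zero    = lookup row u
  adj′ (suc u) (suc v) = adj G u v
  irrefl′ : ∀ v → adj′ v v ≡ false
  irrefl′ zero    = refl
  irrefl′ (suc v) = irrefl G v
  symm′ : ∀ u v → adj′ u v ≡ adj′ v u
  symm′ zero    zero    = refl
  symm′ zero    (suc v) = refl
  symm′ (suc u) zero    = refl
  symm′ (suc u) (suc v) = symm G u v

uncone : ∀ {n} → Graph (suc n) → Graph n
uncone G = record
  { adj    = λ u v → adj G (suc u) (suc v)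
  ; irrefl = λ v → irrefl G (suc v)
  ; symm   = λ u v → symm G (suc u) (suc v)
  }

-- Graphs carry proofs, so they are compared through `adj`. Irreflexivity and symmetry supply the
-- diagonal entry and the first column.
adj-≗-suc : ∀ {n} (G H : Graph (suc n)) →
            (∀ v → adj G zero (suc v) ≡ adj H zero (suc v)) →
            (∀ u v → adj (uncone G) u v ≡ adj (uncone H) u v) →
            ∀ u v → adj G u v ≡ adj H u v
adj-≗-suc G H row rest zero    zero    = trans (irrefl G zero) (sym (irrefl H zero))
adj-≗-suc G H row rest zero    (suc v) = row v
adj-≗-suc G H row rest (suc u) zero    = trans (symm G _ _) (trans (row u) (symm H _ _))
adj-≗-suc G H row rest (suc u) (suc v) = rest u v

decode : ∀ n → Vec Bool (pairs n) → Graph n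
decode zero    _ = record { adj = λ () ; irrefl = λ () ; symm = λ () }
decode (suc n) w = cone (take n w) (decode n (drop n w))

decode-injective : ∀ n {w w′} → (∀ u v → adj (decode n w) u v ≡ adj (decode n w′) u v) → w ≡ w′
decode-injective zero    {[]} {[]} _ = refl
decode-injective (suc n) {w} {w′} e = begin
  w                             ≡⟨ Vec.take++drop≡id n w ⟨
  take n w Vec.++ drop n w      ≡⟨ cong₂ Vec._++_ row (decode-injective n λ u v → e (suc u) (suc v)) ⟩
  take n w′ Vec.++ drop n w′    ≡⟨ Vec.take++drop≡id n w′ ⟩
  w′                            ∎
  where
  open ≡-Reasoning
  row : take n w ≡ take n w′
  row = trans (sym (Vec.tabulate∘lookup _))
          (trans (Vec.tabulate-cong λ v → e zero (suc v)) (Vec.tabulate∘lookup _))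

decode-surjective : ∀ {n} (G : Graph n) → ∃[ w ] ∀ u v → adj G u v ≡ adj (decode n w) u v
decode-surjective {zero}  G = [] , λ ()
decode-surjective {suc n} G with decode-surjective (uncone G)
... | w , e = row Vec.++ w , adj-≗-suc G (decode (suc n) (row Vec.++ w))
    (λ v → sym (trans (cong (λ r → lookup r v) (Vec.++-injectiveˡ (take n (row Vec.++ w)) row eq)) (Vec.lookup∘tabulate _ v)))
    (λ u v → trans (e u v) (cong (λ z → adj (decode n z) u v) (sym (Vec.++-injectiveʳ (take n (row Vec.++ w)) row eq))))
  where
  row = tabulate λ v → adj G zero (suc v)
  -- Splitting the concatenation again and cancelling yields both halves: the row for the new vertex
  -- and the code `w` for the others.
  eq : take n (row Vec.++ w) Vec.++ drop n (row Vec.++ w) ≡ row Vec.++ w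
  eq = Vec.take++drop≡id n (row Vec.++ w)

graphs : ∀ n → List (Graph n)
graphs n = map (decode n) (subsets (pairs n))

graphs-complete : ∀ {n} (G : Graph n) → ∃[ H ] H ∈ˡ graphs n × G ≅ H
graphs-complete G =
  let w , e = decode-surjective G in _ , ∈-map⁺ _ (∈-subsets w) , adj-≗⇒≅ e

-- A labelled graph is recovered from the representative of its class and an isomorphism onto it, by
-- pulling the adjacency back. The isomorphism is recorded as a bare function, hence the factor
-- `n ^ n`.
2^pairs≤classes*n^n : ∀ {n c} → Classes {n} (λ _ → ⊤) c → 2 ^ pairs n ≤ c * n ^ n
2^pairs≤classes*n^n {n} {c} C = injective⇒≤ {f = code} code-injective
  where
  open Classes C
  graph : Fin (2 ^ pairs n) → Graph n
  graph i = decode n (finToBits (pairs n) i)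
  class : ∀ i → ∃[ j ] graph i ≅ rep j
  class i = complete (graph i) tt
  relabelling : Fin (2 ^ pairs n) → Fin n → Fin n
  relabelling i u = bij (proj₂ (class i)) ⟨$⟩ʳ u
  code : Fin (2 ^ pairs n) → Fin (c * n ^ n)
  code i = combine (proj₁ (class i)) (funToFin (relabelling i))
  code-injective : Injective _≡_ _≡_ code
  code-injective {i} {j} e with combine-injective _ _ _ _ e
  ... | r≡ , π≡ = finToBits-injective (pairs n) (decode-injective n λ u v → begin
    adj (graph i) u v                                              ≡⟨ preserve (proj₂ (class i)) u v ⟩
    adj (rep (proj₁ (class i))) (relabelling i u) (relabelling i v)
      ≡⟨ cong₂ (adj (rep (proj₁ (class i)))) (funToFin-injective π≡ u) (funToFin-injective π≡ v) ⟩
    adj (rep (proj₁ (class i))) (relabelling j u) (relabelling j v)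
      ≡⟨ cong (λ r → adj (rep r) (relabelling j u) (relabelling j v)) r≡ ⟩
    adj (rep (proj₁ (class j))) (relabelling j u) (relabelling j v) ≡⟨ preserve (proj₂ (class j)) u v ⟨
    adj (graph j) u v                                              ∎)
    where open ≡-Reasoning

-- Graphs with a large homogeneous set

-- `b` is the common adjacency value: `false` describes independent sets and `true` cliques, so that
-- one argument serves both hypotheses.
Homogeneous : Bool → ∀ {n} → Graph n → Subset n → Set
Homogeneous b G A = ∀ u v → u ∈ A → v ∈ A → u ≢ v → adj G u v ≡ b

-- The first argument tells whether the preceding vertex lies in the set. If it does, its pairs with
-- members of `A` have a known value, and only those leading to the complement must be recorded.
undetermined : Bool → ∀ {n} → Subset n → Subset n
undetermined inside  A = ∁ A
undetermined outside A = full

-- The number of pairs not contained in A.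
free : ∀ {n} → Subset n → ℕ
free []      = 0
free (s ∷ A) = ∣ undetermined s A ∣ + free A

-- Row by row: a first vertex inside the set has `∣ A ∣` determined pairs, which is the increment of
-- `pairs` at `∣ A ∣`.
free+pairs : ∀ {n} (A : Subset n) → free A + pairs ∣ A ∣ ≡ pairs n
free+pairs []                  = refl
free+pairs {suc n} (outside ∷ A) =
  trans (+-assoc ∣ full {n} ∣ (free A) _) (cong₂ _+_ (∣⊤∣≡n n) (free+pairs A))
free+pairs {suc n} (inside ∷ A)  = begin
  ∣ ∁ A ∣ + free A + (∣ A ∣ + pairs ∣ A ∣)    ≡⟨ +-interchange (∣ ∁ A ∣) (free A) (∣ A ∣) (pairs ∣ A ∣) ⟩
  ∣ ∁ A ∣ + ∣ A ∣ + (free A + pairs ∣ A ∣)    ≡⟨ cong₂ _+_ (trans (cong (_+ ∣ A ∣) (∣∁p∣≡n∸∣p∣ A)) (m∸n+n≡m (∣p∣≤n A))) (free+pairs A) ⟩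
  n + pairs n                                 ∎
  where
  open ≡-Reasoning
  +-interchange : ∀ w x y z → w + x + (y + z) ≡ w + y + (x + z)
  +-interchange = solve-∀

-- Larger sets leave fewer free pairs, so one code length serves all sets with at least `k`
-- elements.
free≤ : ∀ {n k} (A : Subset n) → k ≤ ∣ A ∣ → free A ≤ pairs n ∸ pairs k
free≤ {n} {k} A k≤ = begin
  free A                                   ≡⟨ m+n∸n≡m (free A) (pairs ∣ A ∣) ⟨
  free A + pairs ∣ A ∣ ∸ pairs ∣ A ∣       ≡⟨ cong (_∸ pairs ∣ A ∣) (free+pairs A) ⟩
  pairs n ∸ pairs ∣ A ∣                    ≤⟨ ∸-monoʳ-≤ (pairs n) (pairs-mono-≤ k≤) ⟩
  pairs n ∸ pairs k                        ∎
  where open ≤-Reasoning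

firstRow : ∀ {n} s (A : Subset n) → Graph (suc n) → Vec Bool ∣ undetermined s A ∣
firstRow s A G = tabulate λ i → adj G zero (suc (enum (undetermined s A) i))

encode : ∀ {n} (A : Subset n) → Graph n → Vec Bool (free A)
encode []      G = []
encode (s ∷ A) G = firstRow s A G Vec.++ encode A (uncone G)

-- A pair that is not recorded lies inside `A`, where both graphs have the value `b`; every other
-- pair is read off at its position in a row.
encode-injective : ∀ b {n} (A : Subset n) (G H : Graph n) → Homogeneous b G A → Homogeneous b H A →
                   encode A G ≡ encode A H → ∀ u v → adj G u v ≡ adj H u v
encode-injective b []      G H hG hH e ()
encode-injective b {suc n} (s ∷ A) G H hG hH e = adj-≗-suc G H (row s hG hH row≡)
  (encode-injective b A (uncone G) (uncone H) (restrict G hG) (restrict H hH) (Vec.++-injectiveʳ (firstRow s A G) _ e))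
  where
  row≡ = Vec.++-injectiveˡ (firstRow s A G) (firstRow s A H) e
  restrict : ∀ (K : Graph (suc n)) → Homogeneous b K (s ∷ A) → Homogeneous b (uncone K) A
  restrict K hK u v u∈ v∈ u≢v = hK _ _ (there u∈) (there v∈) λ { refl → u≢v refl }
  entry : ∀ s → firstRow s A G ≡ firstRow s A H → ∀ {v} → v ∈ undetermined s A →
          adj G zero (suc v) ≡ adj H zero (suc v)
  entry s e {v} v∈ = subst (λ v → adj G zero (suc v) ≡ adj H zero (suc v)) (enum-pos v v∈)
    (trans (sym (Vec.lookup∘tabulate _ i)) (trans (cong (λ r → lookup r i) e) (Vec.lookup∘tabulate _ i)))
    where i = pos v v∈
  row : ∀ s → Homogeneous b G (s ∷ A) → Homogeneous b H (s ∷ A) → firstRow s A G ≡ firstRow s A H →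
        ∀ v → adj G zero (suc v) ≡ adj H zero (suc v)
  row outside hG hH e v = entry outside e ∈⊤
  row inside  hG hH e v with v ∈? A
  ... | yes v∈ = trans (hG _ _ here (there v∈) λ ()) (sym (hH _ _ here (there v∈) λ ()))
  ... | no  v∉ = entry inside e (x∉p⇒x∈∁p v∉)

LargeHomogeneous : Bool → ℕ → ∀ {n} → Graph n → Set
LargeHomogeneous b k G = ∃[ A ] k ≤ ∣ A ∣ × Homogeneous b G A

-- The set is stored first, in `n` bits, because the layout of the rest depends on it. Padding makes
-- the total length independent of the set.
homogeneousCode : ∀ {b k n} (G : Graph n) → LargeHomogeneous b k G → Vec Bool (n + (pairs n ∸ pairs k))
homogeneousCode G (A , k≤ , _) = A Vec.++ padRight (free≤ A k≤) false (encode A G)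

padRight-injective : ∀ {m n} (p q : m ≤ n) {v w : Vec Bool m} →
                     padRight p false v ≡ padRight q false w → v ≡ w
padRight-injective p q {v} {w} e with ≤-irrelevant p q
... | refl = trans (sym (Vec.truncate-padRight p false v))
               (trans (cong (truncate p) e) (Vec.truncate-padRight p false w))

homogeneousCode-injective : ∀ {b k n} (G H : Graph n) (lG : LargeHomogeneous b k G) (lH : LargeHomogeneous b k H) →
                            homogeneousCode G lG ≡ homogeneousCode H lH → G ≅ H
homogeneousCode-injective {b} G H (A , k≤ , hG) (B , k≤′ , hH) e
  with Vec.++-injective A B e
... | refl , e′ = adj-≗⇒≅ (encode-injective b A G H hG hH (padRight-injective (free≤ A k≤) (free≤ A k≤′) e′))

-- Coefficients of the generating polynomial

X^-coeff≤1 : ∀ s k → coeff (X^ s) k ≤ 1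
X^-coeff≤1 zero    zero    = ≤-refl
X^-coeff≤1 zero    (suc k) = z≤n
X^-coeff≤1 (suc s) zero    = z≤n
X^-coeff≤1 (suc s) (suc k) = X^-coeff≤1 s k

X^-coeff≡0 : ∀ {s k} → s < k → coeff (X^ s) k ≡ 0
X^-coeff≡0 {zero}  (s≤s _)   = refl
X^-coeff≡0 {suc s} (s≤s s<k) = X^-coeff≡0 s<k

sum-map≤length : ∀ {S : Set} (t : S → ℕ) → (∀ x → t x ≤ 1) → ∀ xs → sum (map t xs) ≤ length xs
sum-map≤length t t≤1 []       = z≤n
sum-map≤length t t≤1 (x ∷ xs) = +-mono-≤ (t≤1 x) (sum-map≤length t t≤1 xs)

sum-map≡0 : ∀ {S : Set} (t : S → ℕ) xs → (∀ {x} → x ∈ˡ xs → t x ≡ 0) → sum (map t xs) ≡ 0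
sum-map≡0 t []       t≡0 = refl
sum-map≡0 t (x ∷ xs) t≡0 = cong₂ _+_ (t≡0 (here refl)) (sum-map≡0 t xs (t≡0 ∘ there))

length-subsets : ∀ n → length (subsets n) ≡ 2 ^ n
length-subsets zero    = refl
length-subsets (suc n) = begin
  length (map (outside ∷_) (subsets n) ++ map (inside ∷_) (subsets n))
    ≡⟨ length-++ (map (outside ∷_) (subsets n)) ⟩
  length (map (outside ∷_) (subsets n)) + length (map (inside ∷_) (subsets n))
    ≡⟨ cong₂ _+_ (trans (length-map _ (subsets n)) (length-subsets n)) (trans (length-map _ (subsets n)) (length-subsets n)) ⟩
  2 ^ n + 2 ^ n
    ≡⟨ 2^n+2^n≡2^[1+n] n ⟩
  2 ^ suc n
    ∎
  where open ≡-Reasoning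

module _ (Q : GraphProperty) (Q? : Decider Q) where

  -- Each of at most `2 ^ n` subsets contributes at most 1. The bound `2 ^ suc n` makes this strict,
  -- as `fromℕ<` requires, and remains a power of two.
  genPoly-coeff< : ∀ {n} (G : Graph n) k → coeff (genPoly Q Q? G) k < 2 ^ suc n
  genPoly-coeff< {n} G k = begin-strict
    coeff (genPoly Q Q? G) k              ≡⟨ coeff-sum _ As k ⟩
    sum (map (λ A → coeff (X^ ∣ A ∣) k) As) ≤⟨ sum-map≤length _ (λ A → X^-coeff≤1 ∣ A ∣ k) As ⟩
    length As                             ≤⟨ length-filter _ (subsets n) ⟩
    length (subsets n)                    ≡⟨ length-subsets n ⟩
    2 ^ n                                 <⟨ ^-monoʳ-< 2 (s≤s (s≤s z≤n)) (n<1+n n) ⟩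
    2 ^ suc n                             ∎
    where
    open ≤-Reasoning
    As = filter (λ A → Q? (G [ A ])) (subsets n)

  genPoly-coeff≡0 : ∀ {n} (G : Graph n) {d} → (∀ A → Holds Q (G [ A ]) → ∣ A ∣ < d) →
                    ∀ {k} → d ≤ k → coeff (genPoly Q Q? G) k ≡ 0
  genPoly-coeff≡0 {n} G small {k} d≤k = trans (coeff-sum _ As k) (sum-map≡0 _ As λ {A} A∈ →
    X^-coeff≡0 (<-≤-trans (small A (proj₂ (∈-filter⁻ (λ A → Q? (G [ A ])) {xs = subsets n} A∈))) d≤k))
    where As = filter (λ A → Q? (G [ A ])) (subsets n)

  polyCode : ∀ {n} → Graph n → (d : ℕ) → Fin ((2 ^ suc n) ^ d)
  polyCode G d = funToFin {d} λ i → fromℕ< (genPoly-coeff< G (toℕ i))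

  -- Coefficients below `d` are stored in the code; from `d` on they vanish for both graphs.
  polyCode-injective : ∀ {n} (G H : Graph n) d →
                       (∀ A → Holds Q (G [ A ]) → ∣ A ∣ < d) → (∀ A → Holds Q (H [ A ]) → ∣ A ∣ < d) →
                       polyCode G d ≡ polyCode H d → genPoly Q Q? G ≈ genPoly Q Q? H
  polyCode-injective G H d sG sH e k with k <? d
  ... | no  k≮d = trans (genPoly-coeff≡0 G sG (≮⇒≥ k≮d)) (sym (genPoly-coeff≡0 H sH (≮⇒≥ k≮d)))
  ... | yes k<d = subst (λ k → coeff (genPoly Q Q? G) k ≡ coeff (genPoly Q Q? H) k) (toℕ-fromℕ< k<d)
    (fromℕ<-injective _ _ (genPoly-coeff< G _) (genPoly-coeff< H _) (funToFin-injective e (fromℕ< k<d)))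

-- A subset of the vertices of G[A], as a subset of the vertices of G.
lift : ∀ {n} (A : Subset n) → Subset ∣ A ∣ → Subset n
lift []            []      = []
lift (inside  ∷ A) (s ∷ B) = s ∷ lift A B
lift (outside ∷ A) B       = outside ∷ lift A B

∣lift∣ : ∀ {n} (A : Subset n) B → ∣ lift A B ∣ ≡ ∣ B ∣
∣lift∣ []            []            = refl
∣lift∣ (inside  ∷ A) (inside  ∷ B) = cong suc (∣lift∣ A B)
∣lift∣ (inside  ∷ A) (outside ∷ B) = ∣lift∣ A B
∣lift∣ (outside ∷ A) B             = ∣lift∣ A B

∈-lift : ∀ {n} (A : Subset n) B {v} → v ∈ lift A B → ∃[ i ] i ∈ B × enum A i ≡ v
∈-lift (inside  ∷ A) (s ∷ B) here       = zero , here , refl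
∈-lift (inside  ∷ A) (s ∷ B) (there v∈) = let i , i∈ , e = ∈-lift A B v∈ in suc i , there i∈ , cong suc e
∈-lift (outside ∷ A) B       (there v∈) = let i , i∈ , e = ∈-lift A B v∈ in i , i∈ , cong suc e

lift-homogeneous : ∀ {b n} (G : Graph n) A {B} → Homogeneous b (G [ A ]) B → Homogeneous b G (lift A B)
lift-homogeneous G A {B} h u v u∈ v∈ u≢v with ∈-lift A B u∈ | ∈-lift A B v∈
... | i , i∈ , refl | j , j∈ , refl = h i j i∈ j∈ λ { refl → u≢v refl }

-- Counting the unique graphs

HomogeneityFunction : Bool → GraphProperty → (ℕ → ℕ) → Set
HomogeneityFunction b Q f = ∀ {n} (G : Graph n) → Holds Q G → ∃[ A ] ∣ A ∣ ≡ f n × Homogeneous b G A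

homogeneityFunction : ∀ {Q f} → IndependenceFunction Q f ⊎ CliqueFunction Q f → ∃[ b ] HomogeneityFunction b Q f
homogeneityFunction (inj₁ ind) = false , λ G QG →
  let A , e , h = ind G QG in A , e , λ u v u∈ v∈ _ → h u v u∈ v∈
homogeneityFunction (inj₂ clq) = true , clq

module _ {Q : GraphProperty} {f : ℕ → ℕ} {b : Bool} (hom : HomogeneityFunction b Q f)
         {a : ℕ} .{{_ : NonZero a}} (n≤f*a : ∀ n → n ≤ f n * a) where

  -- A homogeneous set of `G [ A ]` lifts to `G`, so the one of size `f ∣ A ∣` has fewer than `k`
  -- elements, while `∣ A ∣` is at most `f ∣ A ∣ * a`.
  members-small : ∀ {k n} (G : Graph n) → ¬ LargeHomogeneous b k G →
                  ∀ A → Holds Q (G [ A ]) → ∣ A ∣ < k * a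
  members-small {k} G ¬large A QA with hom (G [ A ]) QA
  ... | B , ∣B∣≡ , h = ≤-<-trans (n≤f*a ∣ A ∣) (*-monoˡ-< a (≰⇒> λ k≤ →
    ¬large (lift A B , subst (k ≤_) (sym (trans (∣lift∣ A B) ∣B∣≡)) k≤ , lift-homogeneous G A h)))

  -- The code of a representative with a large homogeneous set determines its adjacency; the code of
  -- any other determines its polynomial. The disjoint union of the two code sets gives the sum.
  unique-classes≤ : (em : ExcludedMiddle 0ℓ) (Q? : Decider Q) → ∀ {n c} k → Classes (IsUnique (P[ Q ] Q?) {n}) c →
                    c ≤ (2 ^ suc n) ^ (k * a) + 2 ^ (n + (pairs n ∸ pairs k))
  unique-classes≤ em Q? {n} {c} k C = injective⇒≤ {f = join _ _ ∘ code}
    λ e → code-injective (join-injective ((2 ^ suc n) ^ (k * a)) _ e)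
    where
    open Classes C
    code : Fin c → Fin ((2 ^ suc n) ^ (k * a)) ⊎ Fin (2 ^ (n + (pairs n ∸ pairs k)))
    code i with em {LargeHomogeneous b k (rep i)}
    ... | yes large = inj₂ (bitsToFin (homogeneousCode (rep i) large))
    ... | no  _     = inj₁ (polyCode Q Q? (rep i) (k * a))
    code-injective : ∀ {i j} → code i ≡ code j → i ≡ j
    code-injective {i} {j} e with em {LargeHomogeneous b k (rep i)} | em {LargeHomogeneous b k (rep j)}
    ... | yes li | yes lj = distinct i j (homogeneousCode-injective (rep i) (rep j) li lj (bitsToFin-injective (inj₂-injective e)))
    -- Here uniqueness enters: `rep i` has the polynomial of the unique graph `rep j`, so the two
    -- are isomorphic.
    ... | no ¬li | no ¬lj = distinct i j (rep-S j (rep i) λ m → sym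
      (polyCode-injective Q Q? (rep i) (rep j) (k * a) (members-small (rep i) ¬li) (members-small (rep j) ¬lj) (inj₁-injective e) m))

-- Asymptotics

n<2^n : ∀ n → n < 2 ^ n
n<2^n zero    = s≤s z≤n
n<2^n (suc n) = begin-strict
  suc n            ≤⟨ n<2^n n ⟩
  2 ^ n            <⟨ ^-monoʳ-< 2 (s≤s (s≤s z≤n)) (n<1+n n) ⟩
  2 ^ suc n        ∎
  where open ≤-Reasoning

-- With `t = l ∸ c`, the factors are bounded separately by `2 ^ c` and `2 ^ t`; the latter works
-- because `c < t` gives `suc l ≤ t + t`. It serves to replace log n by `l`, about n/c: crude, but
-- then `n ^ n` costs only a small multiple of n² in the exponent.
c*1+l≤2^l : ∀ c {l} → suc (c + c) ≤ l → c * suc l ≤ 2 ^ l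
c*1+l≤2^l c {l} 2c<l = begin
  c * suc l                    ≤⟨ *-mono-≤ (<⇒≤ (n<2^n c)) 1+l≤ ⟩
  2 ^ c * 2 ^ (l ∸ c)          ≡⟨ ^-distribˡ-+-* 2 c (l ∸ c) ⟨
  2 ^ (c + (l ∸ c))            ≡⟨ cong (2 ^_) c+t≡l ⟩
  2 ^ l                        ∎
  where
  open ≤-Reasoning
  t = l ∸ c
  c+t≡l : c + t ≡ l
  c+t≡l = m+[n∸m]≡n (≤-trans (m≤m+n c c) (≤-trans (n≤1+n _) 2c<l))
  c<t : c < t
  c<t = +-cancelˡ-≤ c _ _ (subst (_≤ c + t) (sym (+-suc c c)) (subst (suc (c + c) ≤_) (sym c+t≡l) 2c<l))
  2t≤2^t : ∀ {t} → 0 < t → t + t ≤ 2 ^ t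
  2t≤2^t {suc t} _ = begin
    suc t + suc t        ≤⟨ +-mono-≤ (n<2^n t) (n<2^n t) ⟩
    2 ^ t + 2 ^ t        ≡⟨ 2^n+2^n≡2^[1+n] t ⟩
    2 ^ suc t            ∎
  1+l≤ : suc l ≤ 2 ^ t
  1+l≤ = begin
    suc l            ≡⟨ cong suc c+t≡l ⟨
    suc c + t        ≤⟨ +-monoˡ-≤ t c<t ⟩
    t + t            ≤⟨ 2t≤2^t (≤-<-trans z≤n c<t) ⟩
    2 ^ t            ∎

2x≤2y⇒x≤y : ∀ {x y} → x + x ≤ y + y → x ≤ y
2x≤2y⇒x≤y {x} {y} p = ≮⇒≥ λ y<x → <⇒≱ (+-mono-< y<x y<x) p

-- The form x ≤ n(n-1)/2 takes without halving or subtraction; this is why the estimates below start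
-- with a doubled left side.
≤pairs : ∀ {x n} → x + x + n ≤ n * n → x ≤ pairs n
≤pairs {x} {n} p = 2x≤2y⇒x≤y (+-cancelʳ-≤ n _ _ (subst (x + x + n ≤_) (sym (2pairs+n≡n² n)) p))

2^x+2^y<2^z : ∀ {x y z} → 2 + x ≤ z → 2 + y ≤ z → 2 ^ x + 2 ^ y < 2 ^ z
2^x+2^y<2^z {x} {y} {suc z} (s≤s x<z) (s≤s y<z) = begin-strict
  2 ^ x + 2 ^ y      <⟨ +-mono-< (^-monoʳ-< 2 1<2 x<z) (^-monoʳ-< 2 1<2 y<z) ⟩
  2 ^ z + 2 ^ z      ≡⟨ 2^n+2^n≡2^[1+n] z ⟩
  2 ^ suc z          ∎
  where
  open ≤-Reasoning
  1<2 = s≤s (s≤s z≤n)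

-- Writing n = c l + r, the threshold k = b l is linear in n, yet b² > 4c makes
-- pairs k dominate l n, and c > 2 a b makes pairs n dominate n k a.
module Threshold (a q : ℕ) where

  b c : ℕ
  b = 8 * a + 8
  c = 3 + (2 * a + 1) * b

  module _ {l n} (cl≤n : c * l ≤ n) (n≤c[1+l] : n ≤ c * suc l)
           (big : 4 * c + b + 2 * q + 4 ≤ l) where

    k : ℕ
    k = b * l

    private
      1≤l : 1 ≤ l
      1≤l = ≤-trans (≤-trans (s≤s z≤n) (m≤n+m 4 (4 * c + b + 2 * q))) big

    -- The saving `pairs k` pays for the multiplier `q`, for `n ^ n` at `l * n` bits, and for the
    -- `n` bits naming the homogeneous set. The constant 2 leaves room for adding two powers of two.
    q+ln+n≤pairs-k : 2 + (q + l * n + n) ≤ pairs k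
    q+ln+n≤pairs-k = ≤pairs (begin
      (2 + (q + l * n + n)) + (2 + (q + l * n + n)) + k  ≡⟨ eq₁ q l n k ⟩
      (2 * q + 4) * 1 + 2 * (l * n) + 2 * n + b * l
        ≤⟨ +-monoˡ-≤ (b * l) (+-mono-≤ (+-mono-≤ (*-monoʳ-≤ (2 * q + 4) 1≤l) (*-monoʳ-≤ 2 (*-monoʳ-≤ l n≤2cl))) (*-monoʳ-≤ 2 n≤2cl)) ⟩
      (2 * q + 4) * l + 2 * (l * (2 * c * l)) + 2 * (2 * c * l) + b * l  ≡⟨ eq₂ q l b c ⟩
      -- All terms linear in `l` are absorbed by one further `l * l`; the hypothesis `big` is chosen
      -- for this.
      4 * c * (l * l) + (4 * c + b + 2 * q + 4) * l      ≤⟨ +-monoʳ-≤ (4 * c * (l * l)) (*-monoˡ-≤ l big) ⟩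
      -- The slack `32 * a + 19` is b² - 4c - 1.
      4 * c * (l * l) + l * l                            ≤⟨ m≤m+n _ ((32 * a + 19) * (l * l)) ⟩
      4 * c * (l * l) + l * l + (32 * a + 19) * (l * l)  ≡⟨ eq₃ a l ⟩
      k * k                                              ∎)
      where
      open ≤-Reasoning
      n≤2cl : n ≤ 2 * c * l
      n≤2cl = begin
        n            ≤⟨ n≤c[1+l] ⟩
        c * suc l    ≤⟨ *-monoʳ-≤ c (+-monoˡ-≤ l 1≤l) ⟩
        c * (l + l)  ≡⟨ eq c l ⟩
        2 * c * l    ∎
        where
        eq : ∀ c l → c * (l + l) ≡ 2 * c * l
        eq = solve-∀
      eq₁ : ∀ q l n k → (2 + (q + l * n + n)) + (2 + (q + l * n + n)) + k ≡ (2 * q + 4) * 1 + 2 * (l * n) + 2 * n + k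
      eq₁ = solve-∀
      eq₂ : ∀ q l b c → (2 * q + 4) * l + 2 * (l * (2 * c * l)) + 2 * (2 * c * l) + b * l ≡ 4 * c * (l * l) + (4 * c + b + 2 * q + 4) * l
      eq₂ = solve-∀
      eq₃ : ∀ a l → 4 * (3 + (2 * a + 1) * (8 * a + 8)) * (l * l) + l * l + (32 * a + 19) * (l * l) ≡ (8 * a + 8) * l * ((8 * a + 8) * l)
      eq₃ = solve-∀

    -- Makes `pairs n ∸ pairs k` a genuine difference.
    k≤n : k ≤ n
    k≤n = ≤-trans (*-monoˡ-≤ l b≤c) cl≤n
      where
      b≤c : b ≤ c
      b≤c = subst (b ≤_) (eq a b) (m≤m+n b (3 + 2 * a * b))
        where
        eq : ∀ a b → b + (3 + 2 * a * b) ≡ 3 + (2 * a + 1) * b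
        eq = solve-∀

    -- The same budget for the polynomial codes, whose `k * a` coefficients take `suc n` bits each.
    q+ln+[1+n]ka≤pairs-n : 2 + (q + l * n + suc n * (k * a)) ≤ pairs n
    q+ln+[1+n]ka≤pairs-n = ≤pairs (begin
      (2 + (q + l * n + suc n * (k * a))) + (2 + (q + l * n + suc n * (k * a))) + n
        ≡⟨ eq₁ q l n k a ⟩
      1 * (2 * q + 4) + k * (2 * a) + 1 * n + (2 * (l * n) + 2 * a * k * n)
        ≤⟨ +-monoˡ-≤ _ (+-mono-≤ (+-monoˡ-≤ (k * (2 * a)) (*-monoˡ-≤ (2 * q + 4) 1≤k)) (*-monoˡ-≤ n 1≤l)) ⟩
      k * (2 * q + 4) + k * (2 * a) + l * n + (2 * (l * n) + 2 * a * k * n)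
        ≡⟨ cong (λ s → s + l * n + (2 * (l * n) + 2 * a * k * n)) (*-distribˡ-+ k (2 * q + 4) (2 * a)) ⟨
      k * (2 * q + 4 + 2 * a) + l * n + (2 * (l * n) + 2 * a * k * n)
        ≤⟨ +-monoˡ-≤ _ (+-monoˡ-≤ (l * n) (*-monoʳ-≤ k 2q+4+2a≤n)) ⟩
      -- This sum dictates `c`: three copies of `l * n`, and `2 * a + 1` copies of `k * n`, where
      -- `k` is `b * l`.
      k * n + l * n + (2 * (l * n) + 2 * a * k * n)
        ≡⟨ eq₂ a b l n ⟩
      c * l * n                                        ≤⟨ *-monoˡ-≤ n cl≤n ⟩
      n * n                                            ∎)
      where
      open ≤-Reasoning
      eq₁ : ∀ q l n k a → (2 + (q + l * n + suc n * (k * a))) + (2 + (q + l * n + suc n * (k * a))) + n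
              ≡ 1 * (2 * q + 4) + k * (2 * a) + 1 * n + (2 * (l * n) + 2 * a * k * n)
      eq₁ = solve-∀
      eq₂ : ∀ a b l n → b * l * n + l * n + (2 * (l * n) + 2 * a * (b * l) * n) ≡ (3 + (2 * a + 1) * b) * l * n
      eq₂ = solve-∀
      1≤k : 1 ≤ k
      1≤k = *-mono-≤ (≤-trans (s≤s z≤n) (m≤n+m 8 (8 * a))) 1≤l
      2q+4+2a≤n : 2 * q + 4 + 2 * a ≤ n
      2q+4+2a≤n = begin
        2 * q + 4 + 2 * a                                ≤⟨ m≤m+n _ (4 * c + 6 * a + 8) ⟩
        2 * q + 4 + 2 * a + (4 * c + 6 * a + 8)          ≡⟨ eq a c q ⟩
        4 * c + b + 2 * q + 4                            ≤⟨ big ⟩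
        l                                                ≤⟨ m≤m+n l _ ⟩
        c * l                                            ≤⟨ cl≤n ⟩
        n                                                ∎
        where
        eq : ∀ a c q → 2 * q + 4 + 2 * a + (4 * c + 6 * a + 8) ≡ 4 * c + (8 * a + 8) + 2 * q + 4
        eq = solve-∀

-- The arbitrary factor `q` expresses negligibility without division.
codes<graphs : ∀ a q → ∃[ N ] ∀ n → N ≤ n → ∃[ k ]
  q * ((2 ^ suc n) ^ (k * a) + 2 ^ (n + (pairs n ∸ pairs k))) * n ^ n < 2 ^ pairs n
codes<graphs a q = l₀ * c , λ n N≤n → bound n N≤n
  where
  open Threshold a q hiding (k)
  -- The first summand yields `n ≤ 2 ^ l`, the second yields `big`.
  l₀ = suc (c + c) + (4 * c + b + 2 * q + 4)
  bound : ∀ n → l₀ * c ≤ n → ∃[ k ]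
    q * ((2 ^ suc n) ^ (k * a) + 2 ^ (n + (pairs n ∸ pairs k))) * n ^ n < 2 ^ pairs n
  bound n N≤n = k , (begin-strict
    q * ((2 ^ suc n) ^ (k * a) + 2 ^ (n + e)) * n ^ n
      ≤⟨ *-mono-≤ (*-monoˡ-≤ ((2 ^ suc n) ^ (k * a) + 2 ^ (n + e)) (<⇒≤ (n<2^n q))) (^-monoˡ-≤ n n≤2^l) ⟩
    2 ^ q * ((2 ^ suc n) ^ (k * a) + 2 ^ (n + e)) * (2 ^ l) ^ n
      ≡⟨ cong₂ (λ x y → 2 ^ q * (x + 2 ^ (n + e)) * y) (^-*-assoc 2 (suc n) (k * a)) (^-*-assoc 2 l n) ⟩
    2 ^ q * (2 ^ (suc n * (k * a)) + 2 ^ (n + e)) * 2 ^ (l * n)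
      ≡⟨ regroup (2 ^ q) (2 ^ (suc n * (k * a))) (2 ^ (n + e)) (2 ^ (l * n)) ⟩
    2 ^ q * 2 ^ (l * n) * 2 ^ (suc n * (k * a)) + 2 ^ q * 2 ^ (l * n) * 2 ^ (n + e)
      ≡⟨ cong₂ _+_ (merge q (l * n) (suc n * (k * a))) (merge q (l * n) (n + e)) ⟨
    2 ^ (q + l * n + suc n * (k * a)) + 2 ^ (q + l * n + (n + e))
      <⟨ 2^x+2^y<2^z (q+ln+[1+n]ka≤pairs-n cl≤n n≤c[1+l] big) exponent ⟩
    2 ^ pairs n ∎)
    where
    open ≤-Reasoning
    l = n ℕ./ c
    n≡ : n ≡ n % c + l * c
    n≡ = m≡m%n+[m/n]*n n c
    l₀≤l : l₀ ≤ l
    l₀≤l = subst (_≤ l) (m*n/n≡m l₀ c) (/-monoˡ-≤ c N≤n)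
    cl≤n : c * l ≤ n
    cl≤n = begin
      c * l             ≡⟨ *-comm c l ⟩
      l * c             ≤⟨ m≤n+m (l * c) (n % c) ⟩
      n % c + l * c     ≡⟨ n≡ ⟨
      n                 ∎
    n≤c[1+l] : n ≤ c * suc l
    n≤c[1+l] = begin
      n                 ≡⟨ n≡ ⟩
      n % c + l * c     ≤⟨ +-monoˡ-≤ (l * c) (<⇒≤ (m%n<n n c)) ⟩
      suc l * c         ≡⟨ *-comm (suc l) c ⟩
      c * suc l         ∎
    big : 4 * c + b + 2 * q + 4 ≤ l
    big = ≤-trans (m≤n+m _ (suc (c + c))) l₀≤l
    n≤2^l : n ≤ 2 ^ l
    n≤2^l = ≤-trans n≤c[1+l] (c*1+l≤2^l c (≤-trans (m≤m+n _ _) l₀≤l))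
    k = b * l
    e = pairs n ∸ pairs k
    regroup : ∀ w x y z → w * (x + y) * z ≡ w * z * x + w * z * y
    regroup = solve-∀
    merge : ∀ x y z → 2 ^ (x + y + z) ≡ 2 ^ x * 2 ^ y * 2 ^ z
    merge x y z = trans (^-distribˡ-+-* 2 (x + y) z) (cong (_* 2 ^ z) (^-distribˡ-+-* 2 x y))
    exponent : 2 + (q + l * n + (n + e)) ≤ pairs n
    exponent = begin
      2 + (q + l * n + (n + e))    ≡⟨ cong (2 +_) (+-assoc (q + l * n) n e) ⟨
      2 + (q + l * n + n) + e      ≤⟨ +-monoˡ-≤ e (q+ln+n≤pairs-k cl≤n n≤c[1+l] big) ⟩
      pairs k + e                  ≡⟨ m+[n∸m]≡n (pairs-mono-≤ (k≤n cl≤n n≤c[1+l] big)) ⟩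
      pairs n                      ∎

-- Convergence of the quotient to zero

quotient⟶0 : (u g : ℕ → ℕ) (g≢0 : ∀ n → NonZero (g n)) →
             (∀ q → ∃[ N ] ∀ n → N ≤ n → q * u n < g n) →
             (λ n → ℚᵘ._/_ (ℤ.+ u n) (g n) {{g≢0 n}}) ⟶ 0ℚᵘ
-- The bound is (p+1)/(d+1), with positive numerator, so `q = suc d` suffices.
quotient⟶0 u g g≢0 small (mkℚᵘ (ℤ.+ suc p) d) _ =
  let N , h = small (suc d) in N , λ n N≤n → fraction (u n) (g n) {{g≢0 n}} (h n N≤n)
  where
  fraction : ∀ u g .{{_ : NonZero g}} → suc d * u < g →
             ℚᵘ.∣ (ℤ.+ u) / g ℚᵘ.- 0ℚᵘ ∣ ℚᵘ.< mkℚᵘ (ℤ.+ suc p) d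
  fraction u (suc g) qu<g = subst (ℚᵘ._< mkℚᵘ (ℤ.+ suc p) d) (cong ℚᵘ.∣_∣ (sym (ℚᵘ.+-identityʳ-≡ (mkℚᵘ (ℤ.+ u) g))))
    (*<* (subst₂ ℤ._<_ (ℤ.pos-* u (suc d)) (ℤ.pos-* (suc p) (suc g)) (ℤ.+<+ (begin-strict
      u * suc d        ≡⟨ *-comm u (suc d) ⟩
      suc d * u        <⟨ qu<g ⟩
      suc g            ≤⟨ m≤m+n (suc g) (p * suc g) ⟩
      suc p * suc g    ∎))))
    where open ≤-Reasoning
quotient⟶0 u g g≢0 small (mkℚᵘ (ℤ.+ zero) d)   (*<* (ℤ.+<+ ()))
quotient⟶0 u g g≢0 small (mkℚᵘ ℤ.-[1+ p ] d) (*<* ())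

n/a≤m⇒n≤m*a : ∀ n m a .{{_ : NonZero a}} → (ℤ.+ m) / 1 ≥ (ℤ.+ n) / a → n ≤ m * a
n/a≤m⇒n≤m*a n m (suc a) (*≤* p) = ℤ.drop‿+≤+
  (subst₂ ℤ._≤_ (ℤ.*-identityʳ (ℤ.+ n)) (sym (ℤ.pos-* m (suc a))) p)

classes-nonZero : ∀ {n c} → Classes {n} (λ _ → ⊤) c → NonZero c
classes-nonZero {n} {zero}  C = contradiction (2^pairs≤classes*n^n C) (<⇒≱ (m^n>0 2 (pairs n)))
classes-nonZero {n} {suc c} C = _

-- Opened only here, because +_ would make expressions with _+_ and ∣_∣ ambiguous.
open import Data.Integer.Base using (+_)

theorem3 : (em : ExcludedMiddle 0ℓ) (Q : GraphProperty) (f : ℕ → ℕ) →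
    IndependenceFunction Q f ⊎ CliqueFunction Q f →
    (a : ℕ) .{{_ : NonZero a}} →
    (∀ (n : ℕ) → (+ f n) / 1 ≥ (+ n) / a) →
    WeaklyDistinguishing (P[ Q ] (λ G → em))
theorem3 em Q f ind⊎clq a f≥n/a = record
  { ∣U∣         = λ n → proj₁ (U n)
  ; ∣𝒢∣         = λ n → proj₁ (𝒢 n)
  ; ∣U∣-size    = λ n → proj₂ (U n)
  ; ∣𝒢∣-size    = λ n → proj₂ (𝒢 n)
  ; ∣𝒢∣-nonZero = 𝒢≢0
  ; limit       = quotient⟶0 _ _ 𝒢≢0 λ q →
      let N , h = codes<graphs a q in N , λ n N≤n → qU<𝒢 q n (h n N≤n)
  }
  where
  P = P[ Q ] (λ G → em)
  U : ∀ n → ∃[ c ] Classes (IsUnique P {n}) c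
  U n = classes em (IsUnique P) (IsUnique-resp-≅ P) (graphs n) graphs-complete
  𝒢 : ∀ n → ∃[ c ] Classes {n} (λ _ → ⊤) c
  𝒢 n = classes em (λ _ → ⊤) (λ _ _ → tt) (graphs n) graphs-complete
  𝒢≢0 : ∀ n → NonZero (proj₁ (𝒢 n))
  𝒢≢0 n = classes-nonZero (proj₂ (𝒢 n))
  qU<𝒢 : ∀ q n →
         (∃[ k ] q * ((2 ^ suc n) ^ (k * a) + 2 ^ (n + (pairs n ∸ pairs k))) * n ^ n < 2 ^ pairs n) →
         q * proj₁ (U n) < proj₁ (𝒢 n)
  -- The class count is bounded below only after multiplication by `n ^ n`, so the comparison is
  -- made there and the factor cancelled.
  qU<𝒢 q n (k , few) = *-cancelʳ-< (n ^ n) _ _ (begin-strict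
    q * proj₁ (U n) * n ^ n    ≤⟨ *-monoˡ-≤ (n ^ n) (*-monoʳ-≤ q U≤) ⟩
    q * ((2 ^ suc n) ^ (k * a) + 2 ^ (n + (pairs n ∸ pairs k))) * n ^ n  <⟨ few ⟩
    2 ^ pairs n                ≤⟨ 2^pairs≤classes*n^n (proj₂ (𝒢 n)) ⟩
    proj₁ (𝒢 n) * n ^ n        ∎)
    where
    open ≤-Reasoning
    U≤ = unique-classes≤ {Q} {f} (proj₂ (homogeneityFunction {Q} {f} ind⊎clq)) (λ m → n/a≤m⇒n≤m*a m (f m) a (f≥n/a m))
           em (λ G → em) k (proj₂ (U n))
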